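{- Let $G$ be any graph and let $U$ be any set. Then exactly one of the following two assertions holds: (i) $G$ contains a comb attached to $U$; (ii) $G$ has a $U$-rank.
   Context: Graphs may be infinite and need not be connected. A ray is a one-way infinite path. A comb is the union of a ray $R$ (its spine) with infinitely many disjoint finite paths, possibly trivial, that have precisely their first vertex on $R$; the last vertices of these paths are its teeth. A comb attached to $U$ is a comb all of whose teeth lie in $U$. The $U$-rank is defined by transfinite recursion. $U$-rank $0$ is assigned to all graphs that contain at most finitely many vertices from $U$. Given an ordinal $\alpha>0$, $U$-rank $\alpha$ is assigned to every graph $G$ that does not already have a $U$-rank $\beta<\alpha$ and which has a finite set $X$ of vertices such that every component of $G-X$ has some $U$-rank $<\alpha$. A graph has a $U$-rank if it is assigned $U$-rank $\alpha$ for some ordinal $\alpha$. -}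

module Defs where

open import Axiom.ExcludedMiddle using (ExcludedMiddle)
open import Data.Empty.Polymorphic using (⊥; ⊥-elim)
open import Data.Fin.Base using (Fin; zero; suc; fromℕ; inject₁)
open import Data.List.Base using (List)
open import Data.List.Membership.Propositional using ()
  renaming (_∈_ to _∈ₗ_; _∉_ to _∉ₗ_)
open import Data.List.Relation.Unary.All using (All)
open import Data.Nat.Base using (ℕ; suc)
open import Data.Product.Base using (∃; Σ-syntax; ∃-syntax; _×_; _,_)
open import Data.Sum.Base using (_⊎_)
open import Data.Sum.Function.Propositional using (_⊎-⇔_)
open import Data.Product.Function.NonDependent.Propositional using (_×-⇔_)
open import Function.Bundles using (_⇔_; mk⇔; Equivalence)
open import Function.Definitions using (Injective)
import Function.Properties.Equivalence as ⇔
open import Induction.WellFounded using (Acc; acc; WellFounded; WfRec; module All; module Some)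
open import Level using (Level) renaming (suc to lsuc)
open import Relation.Binary.Construct.Closure.ReflexiveTransitive using (Star)
open import Relation.Binary.Core using (Rel)
open import Relation.Binary.Definitions using (Symmetric)
open import Relation.Binary.PropositionalEquality using (_≡_; _≢_)
open import Relation.Nullary using (¬_; yes; no; contradiction)
open import Relation.Unary using (Pred; _∈_; _⊆_; _∩_)

private
  variable
    ℓ : Level
    A : Set ℓ

-- Ordinals are represented by well-founded trees: sup⁺ I f denotes the least
-- ordinal strictly greater than every f i.  Each von Neumann ordinal α, being
-- the set of its elements, is the supremum in this sense of all β < α.
-- Different trees may denote the same ordinal; α and β are equal as ordinals
-- when α ≤ β and β ≤ α.

data Ordinal (ℓ : Level) : Set (lsuc ℓ) where
  sup⁺ : (I : Set ℓ) → (I → Ordinal ℓ) → Ordinal ℓ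

infix 4 _≤_ _<_

_≤_ _<_ : Rel (Ordinal ℓ) ℓ
sup⁺ I f ≤ β        = ∀ i → f i < β
α        < sup⁺ J g = ∃[ j ] α ≤ g j

𝟘 : Ordinal ℓ
𝟘 = sup⁺ ⊥ ⊥-elim

≤-refl : (α : Ordinal ℓ) → α ≤ α
≤-refl (sup⁺ I f) i = i , ≤-refl (f i)

mutual
  ≤-trans : (α β γ : Ordinal ℓ) → α ≤ β → β ≤ γ → α ≤ γ
  ≤-trans (sup⁺ I f) β γ α≤β β≤γ i = <-≤-trans (f i) β γ (α≤β i) β≤γ

  <-≤-trans : (α β γ : Ordinal ℓ) → α < β → β ≤ γ → α < γ
  <-≤-trans α (sup⁺ J g) γ (j , α≤gj) β≤γ = ≤-<-trans α (g j) γ α≤gj (β≤γ j)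

  ≤-<-trans : (α β γ : Ordinal ℓ) → α ≤ β → β < γ → α < γ
  ≤-<-trans α β (sup⁺ K h) α≤β (k , β≤hk) = k , ≤-trans α β (h k) α≤β β≤hk

≮⇒≥ : ExcludedMiddle ℓ → (α β : Ordinal ℓ) → ¬ α < β → β ≤ α
≮⇒≥ em α (sup⁺ J g) α≮β j with em {g j < α}
... | yes gj<α = gj<α
... | no  gj≮α = contradiction (j , ≮⇒≥ em (g j) α gj≮α) α≮β

<-wellFounded : WellFounded (_<_ {ℓ})
<-wellFounded α = accessible α α (≤-refl α)
  where
  accessible : (β α : Ordinal ℓ) → α ≤ β → Acc _<_ α
  accessible (sup⁺ J g) α α≤β = acc λ {γ} γ<α →
    let (j , γ≤gj) = <-≤-trans γ α (sup⁺ J g) γ<α α≤β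
    in  accessible (g j) γ γ≤gj

-- The vertices of a graph form a subset of an ambient set A.  In this way a
-- graph and its subgraphs have the same type, and a set U ⊆ A need not
-- consist of vertices.

record Graph {ℓ} (A : Set ℓ) : Set (lsuc ℓ) where
  field
    V          : Pred A ℓ
    E          : Rel A ℓ
    E-sym      : Symmetric E
    E-irrefl   : ∀ {v} → ¬ E v v
    E-incident : ∀ {u v} → E u v → u ∈ V

open Graph public

infix 4 _⊑_
infixl 6 _-_

_⊑_ : {A : Set ℓ} → Graph A → Graph A → Set ℓ
H ⊑ G = V H ⊆ V G × (∀ {u v} → E H u v → E G u v)

_-_ : Graph A → List A → Graph A
(G - X) .V v                            = v ∈ V G × v ∉ₗ X
(G - X) .E u v                          = E G u v × u ∉ₗ X × v ∉ₗ X
(G - X) .E-sym (uv , u∉X , v∉X)         = E-sym G uv , v∉X , u∉X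
(G - X) .E-irrefl (vv , _)              = E-irrefl G vv
(G - X) .E-incident (uv , u∉X , _)      = E-incident G uv , u∉X

Connected : {A : Set ℓ} → Graph A → Set ℓ
Connected G = ∃ (V G) × (∀ {u v} → u ∈ V G → v ∈ V G → Star (E G) u v)

IsComponent : {A : Set ℓ} → Graph A → Graph A → Set (lsuc ℓ)
IsComponent C G =
  C ⊑ G × Connected C × (∀ D → D ⊑ G → Connected D → C ⊑ D → D ⊑ C)

record Ray {ℓ} {A : Set ℓ} (G : Graph A) : Set ℓ where
  field
    vertex    : ℕ → A
    injective : Injective _≡_ _≡_ vertex
    adjacent  : ∀ n → E G (vertex n) (vertex (suc n))

record Path {ℓ} {A : Set ℓ} (G : Graph A) : Set ℓ where
  field
    length    : ℕ
    vertex    : Fin (suc length) → A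
    inGraph   : ∀ i → vertex i ∈ V G
    injective : Injective _≡_ _≡_ vertex
    adjacent  : ∀ i → E G (vertex (inject₁ i)) (vertex (suc i))

  last : A
  last = vertex (fromℕ length)

-- The paths are indexed by ℕ without loss of generality: being disjoint, they
-- start at distinct vertices of the spine, so there are countably many.

record Comb {ℓ} {A : Set ℓ} (G : Graph A) : Set ℓ where
  field
    spine : Ray G
    path  : ℕ → Path G

  module Spine = Ray spine
  module P (n : ℕ) = Path (path n)

  field
    disjoint       : ∀ {m n} → m ≢ n → ∀ i j → P.vertex m i ≢ P.vertex n j
    first-on-spine : ∀ n → ∃[ k ] P.vertex n zero ≡ Spine.vertex k
    only-first     : ∀ n i k → P.vertex n i ≡ Spine.vertex k → i ≡ zero

  tooth : ℕ → A
  tooth n = P.last n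

ContainsCombAttachedTo : {A : Set ℓ} → Pred A ℓ → Graph A → Set ℓ
ContainsCombAttachedTo U G = Σ[ K ∈ Comb G ] (∀ n → Comb.tooth K n ∈ U)

Finite : {A : Set ℓ} → Pred A ℓ → Set ℓ
Finite {A = A} S = ∃[ xs ] (∀ {v : A} → v ∈ S → v ∈ₗ xs)

module _ {ℓ} {A : Set ℓ} (U : Pred A ℓ) where

  -- The clause for α, where assigned β<α H says that H has been assigned
  -- U-rank β.

  RankClause : (α : Ordinal ℓ) → WfRec _<_ (λ _ → Graph A → Set (lsuc ℓ)) α →
               Graph A → Set (lsuc ℓ)
  RankClause α assigned G =
      (α ≤ 𝟘 × Finite (V G ∩ U))
    ⊎ (𝟘 < α
       × ¬ (∃[ β ] Σ[ β<α ∈ β < α ] assigned {β} β<α G)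
       × Σ[ X ∈ List A ] All (V G) X ×
           (∀ C → IsComponent C (G - X) →
             ∃[ β ] Σ[ β<α ∈ β < α ] assigned {β} β<α C))

  IsAssignedRank : Ordinal ℓ → Graph A → Set (lsuc ℓ)
  IsAssignedRank = All.wfRec <-wellFounded _ _ RankClause

  HasRank : Graph A → Set (lsuc ℓ)
  HasRank G = ∃[ α ] IsAssignedRank α G

  private
    clause-cong : ∀ α {R S : WfRec _<_ (λ _ → Graph A → Set (lsuc ℓ)) α} →
                  (∀ {β} (β<α : β < α) H → R β<α H ⇔ S β<α H) →
                  ∀ G → RankClause α R G ⇔ RankClause α S G
    clause-cong α R⇔S G =
      ⇔.refl ⊎-⇔
      (⇔.refl ×-⇔
        (mk⇔ (λ ¬r (β , β<α , s) → ¬r (β , β<α , from (R⇔S β<α G) s))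
             (λ ¬s (β , β<α , r) → ¬s (β , β<α , to (R⇔S β<α G) r))
        ×-⇔
         mk⇔ (λ (X , X⊆V , r) → X , X⊆V , λ C c →
                let (β , β<α , a) = r C c in β , β<α , to (R⇔S β<α C) a)
             (λ (X , X⊆V , s) → X , X⊆V , λ C c →
                let (β , β<α , a) = s C c in β , β<α , from (R⇔S β<α C) a)))
      where open Equivalence

    irrelevant : ∀ {α} (p q : Acc _<_ α) G →
                 Some.wfRec _ RankClause α p G ⇔ Some.wfRec _ RankClause α q G
    irrelevant {α} (acc p) (acc q) =
      clause-cong α λ β<α → irrelevant (p β<α) (q β<α)

  unfold-rank : ∀ α G →
    IsAssignedRank α G ⇔ RankClause α (λ {β} _ → IsAssignedRank β) G
  unfold-rank α with acc rs ← <-wellFounded α =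
    clause-cong α λ {β} β<α → irrelevant (rs β<α) (<-wellFounded β)

{-# OPTIONS --safe #-}

-- A rank excludes combs by well-founded induction: deleting a finite set X
-- leaves a tail of the comb inside one component.  Conversely, let C be a
-- connected graph without rank and r ∈ C.  Choose a finite path P in C from r
-- to U and delete it.  Some component C′ of C - P has no rank, and, as C is
-- connected, some vertex p of P has a neighbour r′ in C′.  Repeat with C′, r′.
-- The initial segments rPp with the edges p r′ form the spine of a comb, and
-- the remaining segments of the paths P, from p to U, attach it to U.

module Submission where

open import Defs
open import Axiom.ExcludedMiddle using (ExcludedMiddle)
open import Data.Fin.Base using (Fin; zero; suc; fromℕ; inject₁; toℕ)
open import Data.Fin.Induction using (<-weakInduction)
open import Data.Fin.Properties
  using (toℕ-injective; toℕ-inject₁; toℕ-fromℕ; toℕ<n; toℕ≤pred[n])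
open import Data.List.Base using (List; []; _∷_; _++_; applyUpTo)
open import Data.List.Membership.Propositional using ()
  renaming (_∈_ to _∈ₗ_; _∉_ to _∉ₗ_)
open import Data.List.Membership.Propositional.Properties
  using (∈-applyUpTo⁺; ∈-applyUpTo⁻; ∈-++⁺ˡ; ∈-++⁺ʳ)
open import Data.List.Relation.Unary.All as All using (All; [])
open import Data.List.Relation.Unary.All.Properties using (applyUpTo⁺₁)
open import Data.List.Relation.Unary.Any using (here; there)
open import Data.Maybe.Base using (Maybe; just; nothing; maybe)
open import Data.Nat.Base as ℕ using (ℕ; zero; suc; _+_; _∸_; z≤n; s≤s)
import Data.Nat.Properties as ℕ
open import Data.Product.Base
  using (_×_; _,_; proj₁; proj₂; ∃; ∃-syntax; Σ-syntax)
open import Data.Sum.Base using (_⊎_; inj₁; inj₂)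
open import Function.Base using (_∘_)
open import Function.Bundles using (Equivalence)
open import Induction.WellFounded using (Acc; acc)
open import Level using (Level; lift; lower) renaming (suc to lsuc)
open import Relation.Binary.Construct.Closure.ReflexiveTransitive as Star
  using (Star; ε; _◅_; _◅◅_)
open import Relation.Binary.Definitions using (tri<; tri≈; tri>)
open import Relation.Binary.PropositionalEquality
open import Relation.Nullary using (¬_; Dec; yes; no; contradiction)
open import Relation.Nullary.Decidable using (map′; decidable-stable)
open import Relation.Unary using (Pred; _∈_; _⊆_; _∩_)

open Equivalence

private
  variable
    ℓ : Level
    A : Set ℓ

lower-em : ExcludedMiddle (lsuc ℓ) → ExcludedMiddle ℓ
lower-em {ℓ} em = map′ lower (lift {ℓ = lsuc ℓ}) em

⊑-trans : {G H K : Graph A} → G ⊑ H → H ⊑ K → G ⊑ K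
⊑-trans (V₁ , E₁) (V₂ , E₂) = (λ v → V₂ (V₁ v)) , (λ e → E₂ (E₁ e))

-‿mono-⊑ : {G H : Graph A} (X : List A) → G ⊑ H → (G - X) ⊑ (H - X)
-‿mono-⊑ X (V₁ , E₁) =
  (λ (v , v∉X) → V₁ v , v∉X) , (λ (e , ∉X) → E₁ e , ∉X)

-- Components

-- An edge records a walk to its first end only; the edge itself extends this walk to the second
-- end.
component : Graph A → A → Graph A
component G r .V v                      = v ∈ V G × Star (E G) r v
component G r .E u v                    = E G u v × Star (E G) r u
component G r .E-sym (uv , r⇝u)         = E-sym G uv , r⇝u ◅◅ (uv ◅ ε)
component G r .E-irrefl (vv , _)        = E-irrefl G vv
component G r .E-incident (uv , r⇝u)    = E-incident G uv , r⇝u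

component-⊑ : (G : Graph A) (r : A) → component G r ⊑ G
component-⊑ G r = proj₁ , proj₁

component-connected : (G : Graph A) {r : A} → r ∈ V G →
                      Connected (component G r)
component-connected G {r} r∈G = (r , r∈G , ε) , λ (_ , r⇝u) (_ , r⇝v) →
  lift-walk r⇝u (Star.reverse (E-sym G) r⇝u ◅◅ r⇝v)
  where
  lift-walk : ∀ {u v} → Star (E G) r u → Star (E G) u v →
              Star (E (component G r)) u v
  lift-walk r⇝u ε         = ε
  lift-walk r⇝u (e ◅ w⇝v) = (e , r⇝u) ◅ lift-walk (r⇝u ◅◅ (e ◅ ε)) w⇝v

-- Walks of `D` from `r` are also walks of `G`. This makes `component G r` maximal.
connected-⊑-component : {D G : Graph A} {r : A} → D ⊑ G → Connected D →
                        r ∈ V D → D ⊑ component G r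
connected-⊑-component {D = D} (V⊆ , E⊆) (_ , walk) r∈D =
    (λ v∈D → V⊆ v∈D , Star.map E⊆ (walk r∈D v∈D))
  , (λ e → E⊆ e , Star.map E⊆ (walk r∈D (E-incident D e)))

component-isComponent : (G : Graph A) {r : A} → r ∈ V G →
                        IsComponent (component G r) G
component-isComponent G {r} r∈G =
    component-⊑ G r
  , component-connected G r∈G
  , λ D D⊑G conn C⊑D → connected-⊑-component {D = D} {G} D⊑G conn
      (proj₁ C⊑D (r∈G , ε))

-- Mutual inclusion serves as equality of graphs, since predicates with the same elements need not
-- be propositionally equal.
isComponent-cong : {C G H : Graph A} → G ⊑ H → H ⊑ G →
                   IsComponent C G → IsComponent C H
isComponent-cong {C = C} {G} {H} G⊑H H⊑G (C⊑G , conn , max) =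
    ⊑-trans {G = C} {G} {H} C⊑G G⊑H
  , conn
  , λ D D⊑H → max D (⊑-trans {G = D} {H} {G} D⊑H H⊑G)

-- Maximality of `C` reverses its inclusion in `component G r`. Together with `rank-cong`, this
-- carries ranks of rooted components over to arbitrary ones.
isComponent-unique : {C G : Graph A} {r : A} → IsComponent C G → r ∈ V C →
                     C ⊑ component G r × component G r ⊑ C
isComponent-unique {C = C} {G} {r} (C⊑G , conn , max) r∈C =
    C⊑comp
  , max (component G r) (component-⊑ G r)
      (component-connected G (proj₁ C⊑G r∈C)) C⊑comp
  where
  C⊑comp = connected-⊑-component {D = C} {G} C⊑G conn r∈C

-- Ranks

module _ {A : Set ℓ} (U : Pred A ℓ) where

  -- Induction on `α`: a smaller rank of `H` would pass to `G`, and `G - X` and `H - X` have the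
  -- same components.
  rank-cong : ∀ α {G H : Graph A} → G ⊑ H → H ⊑ G →
              IsAssignedRank U α G → IsAssignedRank U α H
  rank-cong α = go (<-wellFounded α)
    where
    go : ∀ {α} → Acc _<_ α → ∀ {G H : Graph A} → G ⊑ H → H ⊑ G →
         IsAssignedRank U α G → IsAssignedRank U α H
    go {α} (acc rs) {G} {H} G⊑H H⊑G a with to (unfold-rank U α G) a
    ... | inj₁ (α≤0 , xs , V∩U⊆xs) =
      from (unfold-rank U α H)
        (inj₁ (α≤0 , xs , λ (v∈H , v∈U) → V∩U⊆xs (proj₁ H⊑G v∈H , v∈U)))
    ... | inj₂ (0<α , least , X , X⊆G , ranked) =
      from (unfold-rank U α H)
        (inj₂ ( 0<α
              , (λ (β , β<α , b) →
                   least (β , β<α , go (rs β<α) {H} {G} H⊑G G⊑H b))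
              , X
              , All.map (proj₁ G⊑H) X⊆G
              , λ C c → ranked C
                  (isComponent-cong {C = C} {H - X} {G - X}
                    (-‿mono-⊑ {G = H} {G} X H⊑G)
                    (-‿mono-⊑ {G = G} {H} X G⊑H) c)))

  finite⇒hasRank : {G : Graph A} → Finite (V G ∩ U) → HasRank U G
  finite⇒hasRank {G} fin = 𝟘 , from (unfold-rank U 𝟘 G) (inj₁ (≤-refl 𝟘 , fin))

  -- The candidate `α` exceeds the ranks of all components; either `G` already has a smaller rank or
  -- the clause for `α` applies. Components are given by roots because vertices, unlike subgraphs,
  -- form a type small enough to index `sup⁺`.
  components⇒hasRank :
    ExcludedMiddle (lsuc ℓ) → (G : Graph A) (X : List A) → All (V G) X →
    (∀ {r} → r ∈ V (G - X) → HasRank U (component (G - X) r)) → HasRank U G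
  components⇒hasRank em G X X⊆G ranked = result em
    where
    rank : Maybe (∃ (V (G - X))) → Ordinal ℓ
    rank = maybe (λ (_ , r∈) → proj₁ (ranked r∈)) 𝟘

    -- The index nothing ensures 𝟘 < α even if G - X is empty.
    α : Ordinal ℓ
    α = sup⁺ _ rank

    rank<α : ∀ i → rank i < α
    rank<α i = i , ≤-refl (rank i)

    result : Dec (∃[ β ] Σ[ β<α ∈ β < α ] IsAssignedRank U β G) → HasRank U G
    result (yes (β , _ , b)) = β , b
    result (no least)        = α , from (unfold-rank U α G)
      (inj₂ (rank<α nothing , least , X , X⊆G , λ C c@(C⊑ , ((r , r∈C) , _) , _) →
        let r∈ = proj₁ C⊑ r∈C
            C⊑comp , comp⊑C = isComponent-unique {C = C} {G - X} c r∈C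
        in  rank (just (r , r∈)) , rank<α (just (r , r∈))
          , rank-cong _ {component (G - X) r} {C} comp⊑C C⊑comp
              (proj₂ (ranked r∈))))

-- Excluding combs

-- Each entry of the list lies in at most one of the disjoint sets `P n`, so it rules out at most
-- one index.
eventually-avoids :
  ExcludedMiddle ℓ → {A : Set ℓ} (P : ℕ → Pred A ℓ) →
  (∀ {m n x} → x ∈ P m → x ∈ P n → m ≡ n) → (xs : List A) →
  ∃[ N ] (∀ {n x} → N ℕ.≤ n → x ∈ P n → x ∉ₗ xs)
eventually-avoids em P disjoint []       = 0 , λ _ _ ()
eventually-avoids em P disjoint (x ∷ xs)
  with eventually-avoids em P disjoint xs | em {∃[ n ] x ∈ P n}
... | N , avoids | no ∉P = N , λ where
  N≤n x∈ (here refl) → ∉P (_ , x∈)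
  N≤n x∈ (there x∈xs) → avoids N≤n x∈ x∈xs
... | N , avoids | yes (k , x∈Pk) = suc k ℕ.⊔ N , λ where
  ≤n x∈ (here refl) →
    ℕ.<-irrefl (disjoint x∈Pk x∈) (ℕ.≤-trans (ℕ.m≤m⊔n (suc k) N) ≤n)
  ≤n x∈ (there x∈xs) → avoids (ℕ.≤-trans (ℕ.m≤n⊔m (suc k) N) ≤n) x∈ x∈xs

ray-walk : {G : Graph A} (R : Ray G) (n : ℕ) →
           Star (E G) (Ray.vertex R 0) (Ray.vertex R n)
ray-walk R zero    = ε
ray-walk R (suc n) = ray-walk R n ◅◅ (Ray.adjacent R n ◅ ε)

module _ (em : ExcludedMiddle ℓ) {A : Set ℓ} where

  private
    on-path : {G : Graph A} → Comb G → ℕ → Pred A ℓ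
    on-path K n x = ∃[ i ] Comb.P.vertex K n i ≡ x

    paths-disjoint : {G : Graph A} (K : Comb G) →
                     ∀ {m n x} → x ∈ on-path K m → x ∈ on-path K n → m ≡ n
    paths-disjoint K {m} {n} (i , eq) (j , eq′) =
      decidable-stable (m ℕ.≟ n) λ m≢n →
        Comb.disjoint K m≢n i j (trans eq (sym eq′))

  -- Some path of the comb avoids the finite list of vertices in `U`, yet its tooth is on that list.
  finite-comb-free : {G : Graph A} (U : Pred A ℓ) → Finite (V G ∩ U) →
                     ¬ ContainsCombAttachedTo U G
  finite-comb-free U (xs , V∩U⊆xs) (K , teeth∈U) =
    let N , avoids = eventually-avoids em (on-path K) (paths-disjoint K) xs
    in  avoids {N} ℕ.≤-refl (_ , refl)
          (V∩U⊆xs (Path.inGraph (Comb.path K N) _ , teeth∈U N))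

  -- Only finitely many spine vertices and paths meet `X`. The rest of the spine is connected in
  -- `G - X`, and every remaining path that starts on it lies in the same component.
  comb-tail : {G : Graph A} (U : Pred A ℓ) (X : List A) →
              ContainsCombAttachedTo U G →
              ∃[ r ] r ∈ V (G - X) ×
                ContainsCombAttachedTo U (component (G - X) r)
  comb-tail {G} U X (K , teeth∈U) =
      Spine.vertex M
    , (E-incident G (Spine.adjacent M) , proj₂ spine-tail ℕ.≤-refl refl)
    , record
        { spine = record
          { vertex    = Ray.vertex spine′
          ; injective = Ray.injective spine′
          ; adjacent  = λ n → Ray.adjacent spine′ n , ray-walk spine′ n
          }
        ; path           = tail-path
        ; disjoint       = λ m≢n → disjoint (m≢n ∘ ℕ.+-cancelʳ-≡ N _ _)
        ; first-on-spine = λ n → let k , eq , _ = start n in k , eq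
        ; only-first     = λ n i k → only-first (n + N) i (k + M)
        }
    , λ n → teeth∈U (n + N)
    where
    open Comb K

    spine-tail : ∃[ M ] (∀ {n x} → M ℕ.≤ n → Spine.vertex n ≡ x → x ∉ₗ X)
    spine-tail = eventually-avoids em (λ n x → Spine.vertex n ≡ x)
      (λ eq eq′ → Spine.injective (trans eq (sym eq′))) X

    M : ℕ
    M = proj₁ spine-tail

    initial : List A
    initial = applyUpTo Spine.vertex M

    -- Avoiding `X` is not enough: a path must also start beyond the discarded initial part of the
    -- spine.
    path-tail : ∃[ N ] (∀ {n x} → N ℕ.≤ n → x ∈ on-path K n → x ∉ₗ initial ++ X)
    path-tail = eventually-avoids em (on-path K) (paths-disjoint K) (initial ++ X)

    N : ℕ
    N = proj₁ path-tail

    avoids : ∀ n i → P.vertex (n + N) i ∉ₗ initial ++ X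
    avoids n i = proj₂ path-tail (ℕ.m≤n+m N n) (i , refl)

    avoids-X : ∀ n i → P.vertex (n + N) i ∉ₗ X
    avoids-X n i = avoids n i ∘ ∈-++⁺ʳ initial

    spine′ : Ray (G - X)
    spine′ = record
      { vertex    = λ n → Spine.vertex (n + M)
      ; injective = λ eq → ℕ.+-cancelʳ-≡ M _ _ (Spine.injective eq)
      ; adjacent  = λ n → Spine.adjacent (n + M)
                        , proj₂ spine-tail (ℕ.m≤n+m M n) refl
                        , proj₂ spine-tail (ℕ.m≤n+m M (suc n)) refl
      }

    start : ∀ n → ∃[ k ] P.vertex (n + N) zero ≡ Spine.vertex (k + M) ×
                         Star (E (G - X)) (Spine.vertex M) (P.vertex (n + N) zero)
    start n with first-on-spine (n + N)
    ... | k , eq = k ∸ M , eq′ , subst (Star _ _) (sym eq′) (ray-walk spine′ (k ∸ M))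
      where
      M≤k : M ℕ.≤ k
      M≤k = ℕ.≮⇒≥ λ k<M → avoids n zero
        (∈-++⁺ˡ (subst (_∈ₗ initial) (sym eq) (∈-applyUpTo⁺ Spine.vertex k<M)))

      eq′ : P.vertex (n + N) zero ≡ Spine.vertex (k ∸ M + M)
      eq′ = trans eq (cong Spine.vertex (sym (ℕ.m∸n+n≡m M≤k)))

    tail-path : ℕ → Path (component (G - X) (Spine.vertex M))
    tail-path n = record
      { length    = P.length (n + N)
      ; vertex    = P.vertex (n + N)
      ; inGraph   = λ i → (P.inGraph (n + N) i , avoids-X n i) , reach i
      ; injective = P.injective (n + N)
      ; adjacent  = λ i → edge i , reach (inject₁ i)
      }
      where
      edge : ∀ i → E (G - X) (P.vertex (n + N) (inject₁ i)) (P.vertex (n + N) (suc i))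
      edge i = P.adjacent (n + N) i , avoids-X n (inject₁ i) , avoids-X n (suc i)

      reach : ∀ i → Star (E (G - X)) (Spine.vertex M) (P.vertex (n + N) i)
      reach = <-weakInduction _ (proj₂ (proj₂ (start n)))
        λ i r⇝ → r⇝ ◅◅ (edge i ◅ ε)

  ranked-comb-free : {G : Graph A} (U : Pred A ℓ) → HasRank U G →
                     ¬ ContainsCombAttachedTo U G
  ranked-comb-free {G} U (α , a) = go (<-wellFounded α) G a
    where
    go : ∀ {α} → Acc _<_ α → (G : Graph A) → IsAssignedRank U α G →
         ¬ ContainsCombAttachedTo U G
    go {α} (acc rs) G a K with to (unfold-rank U α G) a
    ... | inj₁ (_ , fin) = finite-comb-free {G} U fin K
    ... | inj₂ (_ , _ , X , _ , ranked) =
      let r , r∈ , K′ = comb-tail U X K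
          _ , β<α , b = ranked _ (component-isComponent (G - X) r∈)
      in  go (rs β<α) _ b K′

-- Finite paths

-- A finite path v₀ … v_n given by a function on ℕ, whose values beyond the
-- length n are irrelevant.

record Arc {A : Set ℓ} (G : Graph A) : Set ℓ where
  field
    length    : ℕ
    vertex    : ℕ → A
    inGraph   : ∀ {i} → i ℕ.≤ length → vertex i ∈ V G
    injective : ∀ {i j} → i ℕ.≤ length → j ℕ.≤ length →
                vertex i ≡ vertex j → i ≡ j
    adjacent  : ∀ {i} → i ℕ.< length → E G (vertex i) (vertex (suc i))

  vertices : List A
  vertices = applyUpTo vertex (suc length)

  vertex∈ : ∀ {i} → i ℕ.≤ length → vertex i ∈ₗ vertices
  vertex∈ i≤n = ∈-applyUpTo⁺ vertex (s≤s i≤n)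

  ∈vertices⁻ : ∀ {v} → v ∈ₗ vertices → ∃[ i ] i ℕ.≤ length × v ≡ vertex i
  ∈vertices⁻ v∈ with i , s≤s i≤n , eq ← ∈-applyUpTo⁻ vertex v∈ = i , i≤n , eq

module _ {A : Set ℓ} {G : Graph A} where

  singleton : ∀ {x} → x ∈ V G → Arc G
  singleton {x} x∈G = record
    { length    = 0
    ; vertex    = λ _ → x
    ; inGraph   = λ _ → x∈G
    ; injective = λ { z≤n z≤n _ → refl }
    ; adjacent  = λ ()
    }

  cons : ∀ {x} (P : Arc G) → E G x (Arc.vertex P 0) →
         (∀ {i} → i ℕ.≤ Arc.length P → Arc.vertex P i ≢ x) → Arc G
  cons {x} P e x∉P = record
    { length    = suc length
    ; vertex    = vertex′
    ; inGraph   = λ { {zero} _ → E-incident G e ; {suc i} (s≤s i≤) → inGraph i≤ }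
    ; injective = injective′ _ _
    ; adjacent  = λ { {zero} _ → e ; {suc i} (s≤s i<) → adjacent i< }
    }
    where
    open Arc P

    vertex′ : ℕ → A
    vertex′ zero    = x
    vertex′ (suc i) = vertex i

    injective′ : ∀ i j → i ℕ.≤ suc length → j ℕ.≤ suc length →
                 vertex′ i ≡ vertex′ j → i ≡ j
    injective′ zero    zero    _        _        _  = refl
    injective′ zero    (suc j) _        (s≤s j≤) eq = contradiction (sym eq) (x∉P j≤)
    injective′ (suc i) zero    (s≤s i≤) _        eq = contradiction eq (x∉P i≤)
    injective′ (suc i) (suc j) (s≤s i≤) (s≤s j≤) eq = cong suc (injective i≤ j≤ eq)

  drop : (P : Arc G) (k : ℕ) → k ℕ.≤ Arc.length P → Arc G
  drop P k k≤n = record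
    { length    = length ∸ k
    ; vertex    = λ i → vertex (k + i)
    ; inGraph   = inGraph ∘ shift
    ; injective = λ i≤ j≤ eq →
        ℕ.+-cancelˡ-≡ k _ _ (injective (shift i≤) (shift j≤) eq)
    ; adjacent  = λ {i} i< → subst (λ j → E G (vertex (k + i)) (vertex j))
        (sym (ℕ.+-suc k i))
        (adjacent (subst (ℕ._≤ length) (ℕ.+-suc k i) (shift i<)))
    }
    where
    open Arc P

    shift : ∀ {i} → i ℕ.≤ length ∸ k → k + i ℕ.≤ length
    shift i≤ = ℕ.≤-trans (ℕ.+-monoʳ-≤ k i≤) (ℕ.≤-reflexive (ℕ.m+[n∸m]≡n k≤n))

  toPath : Arc G → Path G
  toPath P = record
    { length    = length
    ; vertex    = vertex ∘ toℕ
    ; inGraph   = λ i → inGraph (toℕ≤pred[n] i)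
    ; injective = λ {i} {j} eq →
        toℕ-injective (injective (toℕ≤pred[n] i) (toℕ≤pred[n] j) eq)
    ; adjacent  = λ i → subst (λ k → E G (vertex k) (vertex (suc (toℕ i))))
        (sym (toℕ-inject₁ i)) (adjacent (toℕ<n i))
    }
    where open Arc P

  -- Loop erasure: if `x` recurs on the arc found for the rest of the walk, only the part from that
  -- occurrence is kept; otherwise `x` is prepended.
  walk⇒arc : ExcludedMiddle ℓ → ∀ {x y} → y ∈ V G → Star (E G) x y →
             Σ[ P ∈ Arc G ] Arc.vertex P 0 ≡ x × Arc.vertex P (Arc.length P) ≡ y
  walk⇒arc em y∈G ε = singleton y∈G , refl , refl
  walk⇒arc em {x} y∈G (e ◅ z⇝y) with walk⇒arc em y∈G z⇝y
  ... | P , refl , eq with em {∃[ i ] i ℕ.≤ Arc.length P × Arc.vertex P i ≡ x}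
  ...   | yes (k , k≤n , eq′) =
          drop P k k≤n
        , trans (cong (Arc.vertex P) (ℕ.+-identityʳ k)) eq′
        , trans (cong (Arc.vertex P) (ℕ.m+[n∸m]≡n k≤n)) eq
  ...   | no x∉P = cons P e (λ i≤ eq′ → x∉P (_ , i≤ , eq′)) , refl , eq

-- Traced backwards from `c`, the walk stays in the component until it meets `X`. Hence `p` is the
-- last vertex of the walk in `X`.
edge-into-component :
  ExcludedMiddle ℓ → {A : Set ℓ} (G : Graph A) (X : List A) {r y c : A} →
  c ∈ V (component (G - X) r) → Star (E G) y c →
  y ∈ V (component (G - X) r) ⊎
  ∃[ p ] ∃[ w ] p ∈ₗ X × w ∈ V (component (G - X) r) × E G p w
edge-into-component em G X c∈ ε = inj₁ c∈
edge-into-component em G X {y = y} c∈ (e ◅ z⇝c)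
  with edge-into-component em G X c∈ z⇝c
... | inj₂ edge = inj₂ edge
... | inj₁ z∈@((z∈G , z∉X) , r⇝z) with em {y ∈ₗ X}
...   | yes y∈X = inj₂ (y , _ , y∈X , z∈ , e)
...   | no  y∉X = inj₁ ((E-incident G e , y∉X) , r⇝z ◅◅
                       ((E-sym G e , z∉X , y∉X) ◅ ε))

-- Concatenating the index ranges 0 … b 0, 0 … b 1, 0 … b 2, …

module Concatenation (b : ℕ → ℕ) where

  next : ℕ × ℕ → ℕ × ℕ
  next (n , i) with i ℕ.<? b n
  ... | yes _ = n , suc i
  ... | no  _ = suc n , 0

  position : ℕ → ℕ × ℕ
  position zero    = 0 , 0
  position (suc k) = next (position k)

  next-< : ∀ {n i} → i ℕ.< b n → next (n , i) ≡ (n , suc i)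
  next-< {n} {i} i<b with i ℕ.<? b n
  ... | yes _   = refl
  ... | no  i≮b = contradiction i<b i≮b

  next-end : ∀ n → next (n , b n) ≡ (suc n , 0)
  next-end n with b n ℕ.<? b n
  ... | yes b<b = contradiction b<b (ℕ.<-irrefl refl)
  ... | no  _   = refl

  position-≤ : ∀ k → let n , i = position k in i ℕ.≤ b n
  position-≤ zero    = z≤n
  position-≤ (suc k) with position k
  ... | n , i with i ℕ.<? b n
  ...   | yes i<b = i<b
  ...   | no  _   = z≤n

  private
    -- The number of pairs before `(n , 0)`; each range includes both ends, whence the `suc`.
    offset : ℕ → ℕ
    offset zero    = 0
    offset (suc n) = suc (b n + offset n)

    index : ℕ × ℕ → ℕ
    index (n , i) = i + offset n

    -- A left inverse yields injectivity. A new range is entered only when `i ≡ b n`, so that step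
    -- also raises the index by one.
    index-position : ∀ k → index (position k) ≡ k
    index-position zero    = refl
    index-position (suc k) with position k | position-≤ k | index-position k
    ... | n , i | i≤b | eq with i ℕ.<? b n
    ...   | yes _   = cong suc eq
    ...   | no  i≮b = cong suc (trans (cong (_+ offset n) (sym (ℕ.≤∧≮⇒≡ i≤b i≮b))) eq)

  position-injective : ∀ {k l} → position k ≡ position l → k ≡ l
  position-injective {k} {l} eq =
    trans (sym (index-position k)) (trans (cong index eq) (index-position l))

  -- Lexicographic induction on `(n , i)`. Applied to the end of range `n`, it locates the start of
  -- the `n`-th path on the spine.
  position-surjective : ∀ n {i} → i ℕ.≤ b n → ∃[ k ] position k ≡ (n , i)
  position-surjective zero    {zero} _ = 0 , refl
  position-surjective (suc n) {zero} _ =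
    let k , eq = position-surjective n ℕ.≤-refl
    in  suc k , trans (cong next eq) (next-end n)
  position-surjective n {suc i} i<b =
    let k , eq = position-surjective n (ℕ.<⇒≤ i<b)
    in  suc k , trans (cong next eq) (next-< i<b)

-- Constructing a comb

module _ {A : Set ℓ} (U : Pred A ℓ) where

  -- One round of the construction: up to `branch` the arc belongs to the spine, which continues to
  -- `r′`; from `branch` on it leads to a tooth.
  record Block (C : Graph A) (r : A) (C′ : Graph A) (r′ : A) : Set ℓ where
    field
      arc : Arc C
    open Arc arc public
    field
      starts-at-root : vertex 0 ≡ r
      ends-in-U      : vertex length ∈ U
      branch         : ℕ
      branch≤        : branch ℕ.≤ length
      joined         : E C (vertex branch) r′
      next⊑          : C′ ⊑ C
      next-avoids    : ∀ {i} → i ℕ.≤ length → ¬ vertex i ∈ V C′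

  blocks⇒comb : {G : Graph A} (C : ℕ → Graph A) (r : ℕ → A) → C 0 ⊑ G →
                (∀ n → Block (C n) (r n) (C (suc n)) (r (suc n))) →
                ContainsCombAttachedTo U G
  blocks⇒comb {G} C r C₀⊑G block =
      record
        { spine = record
          { vertex    = spine-vertex
          ; injective = λ {k} {l} eq → position-injective
              (vertex-injective (below k) (below l) eq)
          ; adjacent  = spine-adjacent
          }
        ; path           = path
        ; disjoint       = λ {m} {n} m≢n i j eq → m≢n (cong proj₁
            (vertex-injective (path-≤ m i) (path-≤ n j) eq))
        ; first-on-spine = λ n →
            let k , eq = position-surjective n ℕ.≤-refl
            in  k , trans (cong (B.vertex n) (ℕ.+-identityʳ (B.branch n)))
                          (cong (λ (m , i) → B.vertex m i) (sym eq))
        ; only-first     = only-first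
        }
    -- The path ends at index `branch + (length ∸ branch)` of the arc, which is `length`.
    , λ n → subst U
        (cong (B.vertex n) (sym (trans
          (cong (B.branch n +_) (toℕ-fromℕ _)) (ℕ.m+[n∸m]≡n (B.branch≤ n)))))
        (B.ends-in-U n)
    where
    module B (n : ℕ) = Block (block n)

    C-⊑ : ∀ n → C n ⊑ G
    C-⊑ zero    = C₀⊑G
    C-⊑ (suc n) = ⊑-trans {G = C (suc n)} {C n} {G} (B.next⊑ n) (C-⊑ n)

    C-antitone : ∀ {m n} → m ℕ.≤′ n → V (C n) ⊆ V (C m)
    C-antitone ℕ.≤′-refl       v∈ = v∈
    C-antitone (ℕ.≤′-step m≤n) v∈ = C-antitone m≤n (proj₁ (B.next⊑ _) v∈)

    earlier-avoids : ∀ {m n i j} → m ℕ.< n → i ℕ.≤ B.length m → j ℕ.≤ B.length n →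
                     B.vertex m i ≢ B.vertex n j
    earlier-avoids {m} {n} m<n i≤ j≤ eq = B.next-avoids m i≤
      (subst (_∈ V (C (suc m))) (sym eq)
        (C-antitone (ℕ.≤⇒≤′ m<n) (B.inGraph n j≤)))

    -- Every later arc lies in `C (suc m)`, which arc `m` avoids. This one fact gives injectivity of
    -- the spine, disjointness of the paths and `only-first`.
    vertex-injective : ∀ {m n i j} → i ℕ.≤ B.length m → j ℕ.≤ B.length n →
                       B.vertex m i ≡ B.vertex n j → (m , i) ≡ (n , j)
    vertex-injective {m} {n} i≤ j≤ eq with ℕ.<-cmp m n
    ... | tri< m<n _ _  = contradiction eq (earlier-avoids m<n i≤ j≤)
    ... | tri≈ _ refl _ = cong (m ,_) (B.injective m i≤ j≤ eq)
    ... | tri> _ _ n<m  = contradiction (sym eq) (earlier-avoids n<m j≤ i≤)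

    open Concatenation B.branch

    spine-vertex : ℕ → A
    spine-vertex k = let n , i = position k in B.vertex n i

    below : ∀ k → let n , i = position k in i ℕ.≤ B.length n
    below k = ℕ.≤-trans (position-≤ k) (B.branch≤ _)

    spine-adjacent : ∀ k → E G (spine-vertex k) (spine-vertex (suc k))
    spine-adjacent k with position k | position-≤ k
    ... | n , i | i≤b with i ℕ.<? B.branch n
    ...   | yes i<b = proj₂ (C-⊑ n)
              (B.adjacent n (ℕ.≤-trans i<b (B.branch≤ n)))
    -- Here `i` is the branch index, and the spine crosses to the root of the next block.
    ...   | no  i≮b = proj₂ (C-⊑ n)
              (subst₂ (E (C n))
                (cong (B.vertex n) (sym (ℕ.≤∧≮⇒≡ i≤b i≮b)))
                (sym (B.starts-at-root (suc n)))
                (B.joined n))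

    -- If `branch` equals `length`, this arc is trivial and the branch vertex itself is the tooth.
    tooth-arc : ∀ n → Arc (C n)
    tooth-arc n = drop (B.arc n) (B.branch n) (B.branch≤ n)

    path : ℕ → Path G
    path n = record
      { length    = P.length
      ; vertex    = P.vertex
      ; inGraph   = λ i → proj₁ (C-⊑ n) (P.inGraph i)
      ; injective = P.injective
      ; adjacent  = λ i → proj₂ (C-⊑ n) (P.adjacent i)
      }
      where module P = Path (toPath (tooth-arc n))

    path-≤ : ∀ n (i : Fin (suc (Path.length (path n)))) →
             B.branch n + toℕ i ℕ.≤ B.length n
    path-≤ n i = ℕ.≤-trans (ℕ.+-monoʳ-≤ (B.branch n) (toℕ≤pred[n] i))
      (ℕ.≤-reflexive (ℕ.m+[n∸m]≡n (B.branch≤ n)))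

    only-first : ∀ n i k → Path.vertex (path n) i ≡ spine-vertex k → i ≡ zero
    only-first n i k eq
      with position k | position-≤ k | vertex-injective (path-≤ n i) (below k) eq
    -- Spine indices within a block are at most `branch`, while the path vertex has index
    -- `branch + toℕ i`.
    ... | _ | b+i≤b | refl = toℕ-injective (ℕ.n≤0⇒n≡0
      (ℕ.+-cancelˡ-≤ (B.branch n) _ _
        (ℕ.≤-trans b+i≤b (ℕ.≤-reflexive (sym (ℕ.+-identityʳ _))))))

-- Combs in unranked graphs

module _ (em : ExcludedMiddle (lsuc ℓ)) {A : Set ℓ} (U : Pred A ℓ) where

  unranked-component :
    {G : Graph A} → ¬ HasRank U G → (X : List A) → All (V G) X →
    ∃[ r ] r ∈ V (G - X) × ¬ HasRank U (component (G - X) r)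
  unranked-component {G} unranked X X⊆G
    with em {∃[ r ] r ∈ V (G - X) × ¬ HasRank U (component (G - X) r)}
  ... | yes found = found
  ... | no  none  = contradiction
    (components⇒hasRank U em G X X⊆G λ r∈ →
      decidable-stable em λ unranked′ → none (_ , r∈ , unranked′))
    unranked

  -- A graph without vertices in `U` has rank `𝟘`.
  meets-U : {G : Graph A} → ¬ HasRank U G → ∃ (V G ∩ U)
  meets-U {G} unranked with lower-em em {∃ (V G ∩ U)}
  ... | yes found = found
  ... | no  none  = contradiction
    (finite⇒hasRank U {G} ([] , λ v∈ → contradiction (_ , v∈) none)) unranked

  record Stage : Set (lsuc ℓ) where
    field
      graph     : Graph A
      connected : Connected graph
      unranked  : ¬ HasRank U graph
      root      : A
      root∈     : root ∈ V graph

  open Stage using (graph; root)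

  extend : (S : Stage) → Σ[ T ∈ Stage ] Block U (graph S) (root S) (graph T) (root T)
  extend S
    with (u , u∈G , u∈U) ← meets-U (Stage.unranked S)
    with (P , start≡ , end≡) ← walk⇒arc (lower-em em) u∈G
           (proj₂ (Stage.connected S) (Stage.root∈ S) u∈G)
    with (c , c∈ , unranked′) ← unranked-component (Stage.unranked S)
           (Arc.vertices P) (applyUpTo⁺₁ _ _ λ { (s≤s i≤) → Arc.inGraph P i≤ })
    with edge-into-component (lower-em em) (Stage.graph S) (Arc.vertices P) (c∈ , ε)
           (proj₂ (Stage.connected S) (Arc.inGraph P z≤n) (proj₁ c∈))
  -- The walk starts on the deleted arc, so its first vertex is not in the component.
  ... | inj₁ ((_ , v₀∉P) , _) = contradiction (Arc.vertex∈ P z≤n) v₀∉P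
  ... | inj₂ (p , w , p∈P , w∈ , pw) with Arc.∈vertices⁻ P p∈P
  ...   | i , i≤n , refl =
      record
        { graph     = component (graph S - vertices) c
        ; connected = component-connected (graph S - vertices) c∈
        ; unranked  = unranked′
        -- The new root is the neighbour `w` of `p` rather than `c`, so that the edge `pw` extends
        -- the spine.
        ; root      = w
        ; root∈     = w∈
        }
    , record
        { arc            = P
        ; starts-at-root = start≡
        ; ends-in-U      = subst U (sym end≡) u∈U
        ; branch         = i
        ; branch≤        = i≤n
        ; joined         = pw
        ; next⊑          = (λ ((v∈ , _) , _) → v∈) , λ ((e , _) , _) → e
        ; next-avoids    = λ j≤ ((_ , v∉P) , _) → v∉P (vertex∈ j≤)
        }
    where open Arc P using (vertices; vertex∈)

  unranked⇒comb : {G : Graph A} → ¬ HasRank U G → ContainsCombAttachedTo U G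
  -- As `G` may be disconnected, deleting the empty set selects an unranked component to begin with.
  unranked⇒comb {G} unranked with unranked-component {G} unranked [] []
  ... | s , s∈ , unranked′ =
    blocks⇒comb U (graph ∘ stage) (root ∘ stage)
      ((λ ((v∈ , _) , _) → v∈) , λ ((e , _) , _) → e)
      (proj₂ ∘ extend ∘ stage)
    where
    stage : ℕ → Stage
    stage zero    = record
      { graph     = component (G - []) s
      ; connected = component-connected (G - []) s∈
      ; unranked  = unranked′
      ; root      = s
      ; root∈     = s∈ , ε
      }
    stage (suc n) = proj₁ (extend (stage n))

theorem4 : {ℓ : Level} → ExcludedMiddle (lsuc ℓ) →
    {A : Set ℓ} (G : Graph A) (U : Pred A ℓ) →
    (ContainsCombAttachedTo U G ⊎ HasRank U G) ×
    ¬ (ContainsCombAttachedTo U G × HasRank U G)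
theorem4 em G U = dichotomy em , λ (K , rank) →
  ranked-comb-free (lower-em em) {G = G} U rank K
  where
  dichotomy : Dec (HasRank U G) → ContainsCombAttachedTo U G ⊎ HasRank U G
  dichotomy (yes rank)    = inj₂ rank
  dichotomy (no unranked) = inj₁ (unranked⇒comb em U unranked)
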